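{- Let $n$ be a positive integer. If $n$ is even, then $$\left\lfloor \left(\sum_{k=n}^{\infty} \frac{(-1)^{k}}{J_{k}}\right)^{ -1}\right\rfloor = 2^{n-1}-1.$$
   Context: The Jacobsthal numbers $(J_n)_{n\ge 0}$ are defined by $J_0=0$, $J_1=1$ and $J_{n+2}=J_{n+1}+2J_n$ for $n\ge 0$; the first terms are $0,1,1,3,5,11,21,43,85,\dots$. Here $\lfloor x\rfloor$ denotes the greatest integer not exceeding the real number $x$. -}

module Defs where

open import Data.Integer.Base as ℤ using (ℤ; +_; -1ℤ)
open import Data.Nat.Base as ℕ using (ℕ; zero; suc)
import Data.Nat.Properties as ℕ
open import Data.Product.Base using (Σ; Σ-syntax; _×_; _,_; proj₁; proj₂)
open import Data.Rational.Base as ℚ using (ℚ; 0ℚ; 1ℚ; ½)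
import Data.Rational.Properties as ℚ
open import Data.Rational.Solver using (module +-*-Solver)
open import Data.Sum.Base using (_⊎_; inj₁; inj₂)
open import Relation.Binary.PropositionalEquality using (_≡_; _≢_; refl; sym; trans; cong; cong₂; subst; subst₂)
open import Relation.Nullary using (yes; no; contradiction)

open +-*-Solver using (solve; _:=_; _:+_; _:*_; _:-_; :-_)

halve : ℚ → ℚ
halve ε = ½ ℚ.* ε

halve-pos : ∀ {ε} → 0ℚ ℚ.< ε → 0ℚ ℚ.< halve ε
halve-pos {ε} 0<ε =
  ℚ.positive⁻¹ (½ ℚ.* ε) {{ℚ.pos*pos⇒pos ½ ε {{ℚ.positive 0<ε}}}}

halve-sum : ∀ ε → halve ε ℚ.+ halve ε ≡ ε
halve-sum ε = trans (sym (ℚ.*-distribʳ-+ ε ½ ½)) (ℚ.*-identityˡ ε)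

p≤∣p∣ : ∀ p → p ℚ.≤ ℚ.∣ p ∣
p≤∣p∣ p with ℚ.≤-total 0ℚ p
... | inj₁ 0≤p = ℚ.≤-reflexive (sym (ℚ.0≤p⇒∣p∣≡p 0≤p))
... | inj₂ p≤0 = ℚ.≤-trans p≤0 (ℚ.0≤∣p∣ p)

drop : ∀ p {d q} → 0ℚ ℚ.< d → p ℚ.+ d ℚ.≤ q → p ℚ.≤ q
drop p {d} {q} 0<d p+d≤q = begin
  p            ≡⟨ ℚ.+-identityʳ p ⟨
  p ℚ.+ 0ℚ     ≤⟨ ℚ.+-monoʳ-≤ p (ℚ.<⇒≤ 0<d) ⟩
  p ℚ.+ d      ≤⟨ p+d≤q ⟩
  q            ∎
  where open ℚ.≤-Reasoning

∣p-q∣≡∣q-p∣ : ∀ p q → ℚ.∣ p ℚ.- q ∣ ≡ ℚ.∣ q ℚ.- p ∣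
∣p-q∣≡∣q-p∣ p q = trans
  (cong ℚ.∣_∣ (solve 2 (λ p q → p :- q := :- (q :- p)) refl p q))
  (ℚ.∣-p∣≡∣p∣ (q ℚ.- p))

triangle : ∀ p q r → ℚ.∣ p ℚ.- r ∣ ℚ.≤ ℚ.∣ p ℚ.- q ∣ ℚ.+ ℚ.∣ q ℚ.- r ∣
triangle p q r = subst (ℚ._≤ ℚ.∣ p ℚ.- q ∣ ℚ.+ ℚ.∣ q ℚ.- r ∣)
  (cong ℚ.∣_∣ (solve 3 (λ p q r → (p :- q) :+ (q :- r) := p :- r) refl p q r))
  (ℚ.∣p+q∣≤∣p∣+∣q∣ (p ℚ.- q) (q ℚ.- r))

∣p∣-∣q∣≤∣p-q∣ : ∀ p q → ℚ.∣ p ∣ ℚ.- ℚ.∣ q ∣ ℚ.≤ ℚ.∣ p ℚ.- q ∣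
∣p∣-∣q∣≤∣p-q∣ p q = begin
  ℚ.∣ p ∣ ℚ.- ℚ.∣ q ∣
    ≡⟨ cong (λ r → ℚ.∣ r ∣ ℚ.- ℚ.∣ q ∣) (solve 2 (λ p q → p := (p :- q) :+ q) refl p q) ⟩
  ℚ.∣ (p ℚ.- q) ℚ.+ q ∣ ℚ.- ℚ.∣ q ∣
    ≤⟨ ℚ.+-monoˡ-≤ (ℚ.- ℚ.∣ q ∣) (ℚ.∣p+q∣≤∣p∣+∣q∣ (p ℚ.- q) q) ⟩
  (ℚ.∣ p ℚ.- q ∣ ℚ.+ ℚ.∣ q ∣) ℚ.- ℚ.∣ q ∣
    ≡⟨ solve 2 (λ a b → (a :+ b) :- b := a) refl ℚ.∣ p ℚ.- q ∣ ℚ.∣ q ∣ ⟩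
  ℚ.∣ p ℚ.- q ∣ ∎
  where open ℚ.≤-Reasoning

reverse-triangle : ∀ p q → ℚ.∣ ℚ.∣ p ∣ ℚ.- ℚ.∣ q ∣ ∣ ℚ.≤ ℚ.∣ p ℚ.- q ∣
reverse-triangle p q with ℚ.∣p∣≡p∨∣p∣≡-p (ℚ.∣ p ∣ ℚ.- ℚ.∣ q ∣)
... | inj₁ eq = subst (ℚ._≤ ℚ.∣ p ℚ.- q ∣) (sym eq) (∣p∣-∣q∣≤∣p-q∣ p q)
... | inj₂ eq = subst₂ ℚ._≤_
  (sym (trans eq (solve 2 (λ a b → :- (a :- b) := b :- a) refl ℚ.∣ p ∣ ℚ.∣ q ∣)))
  (∣p-q∣≡∣q-p∣ q p)
  (∣p∣-∣q∣≤∣p-q∣ q p)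

-- Total reciprocal, with the junk value recip 0ℚ = 0ℚ.
recip : ℚ → ℚ
recip p with p ℚ.≟ 0ℚ
... | yes _   = 0ℚ
... | no  p≢0 = (ℚ.1/ p) {{ℚ.≢-nonZero p≢0}}

recip-inverseˡ : ∀ p → p ≢ 0ℚ → recip p ℚ.* p ≡ 1ℚ
recip-inverseˡ p p≢0 with p ℚ.≟ 0ℚ
... | yes p≡0 = contradiction p≡0 p≢0
... | no  p≢0 = ℚ.*-inverseˡ p {{ℚ.≢-nonZero p≢0}}

Cauchy : (ℕ → ℚ) → Set
Cauchy x = ∀ ε → 0ℚ ℚ.< ε →
  Σ[ N ∈ ℕ ] ∀ m n → N ℕ.≤ m → N ℕ.≤ n → ℚ.∣ x m ℚ.- x n ∣ ℚ.< ε

record ℝ : Set where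
  constructor mkℝ
  field
    seq    : ℕ → ℚ
    cauchy : Cauchy seq

open ℝ public

infix  4 _≤_ _<_ _≃_ _#_
infixl 6 _+_ _-_
infix  8 -_

_≤_ : ℝ → ℝ → Set
x ≤ y = ∀ ε → 0ℚ ℚ.< ε → Σ[ N ∈ ℕ ] ∀ n → N ℕ.≤ n → seq x n ℚ.≤ seq y n ℚ.+ ε

_<_ : ℝ → ℝ → Set
x < y = Σ[ δ ∈ ℚ ] 0ℚ ℚ.< δ ×
  (Σ[ N ∈ ℕ ] ∀ n → N ℕ.≤ n → seq x n ℚ.+ δ ℚ.≤ seq y n)

-- Two Cauchy sequences represent the same real.
_≃_ : ℝ → ℝ → Set
x ≃ y = x ≤ y × y ≤ x

-- Apartness, the constructive form of x ≠ y.
_#_ : ℝ → ℝ → Set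
x # y = x < y ⊎ y < x

fromℚ : ℚ → ℝ
fromℚ p = mkℝ (λ _ → p) λ ε 0<ε → 0 , λ _ _ _ _ →
  subst (ℚ._< ε) (sym (cong ℚ.∣_∣ (ℚ.+-inverseʳ p))) 0<ε

fromℤ : ℤ → ℝ
fromℤ k = fromℚ (k ℚ./ 1)

0ℝ : ℝ
0ℝ = fromℚ 0ℚ

_+_ : ℝ → ℝ → ℝ
x + y = mkℝ (λ n → seq x n ℚ.+ seq y n) λ ε 0<ε →
  let (M , hx) = cauchy x (halve ε) (halve-pos 0<ε)
      (N , hy) = cauchy y (halve ε) (halve-pos 0<ε)
  in M ℕ.⊔ N , λ m n p q → begin-strict
    ℚ.∣ (seq x m ℚ.+ seq y m) ℚ.- (seq x n ℚ.+ seq y n) ∣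
      ≡⟨ cong ℚ.∣_∣ (solve 4 (λ a b c d → (a :+ b) :- (c :+ d) := (a :- c) :+ (b :- d)) refl
           (seq x m) (seq y m) (seq x n) (seq y n)) ⟩
    ℚ.∣ (seq x m ℚ.- seq x n) ℚ.+ (seq y m ℚ.- seq y n) ∣
      ≤⟨ ℚ.∣p+q∣≤∣p∣+∣q∣ (seq x m ℚ.- seq x n) (seq y m ℚ.- seq y n) ⟩
    ℚ.∣ seq x m ℚ.- seq x n ∣ ℚ.+ ℚ.∣ seq y m ℚ.- seq y n ∣
      <⟨ ℚ.+-mono-< (hx m n (ℕ.m⊔n≤o⇒m≤o M N p) (ℕ.m⊔n≤o⇒m≤o M N q))
                    (hy m n (ℕ.m⊔n≤o⇒n≤o M N p) (ℕ.m⊔n≤o⇒n≤o M N q)) ⟩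
    halve ε ℚ.+ halve ε
      ≡⟨ halve-sum ε ⟩
    ε ∎
  where open ℚ.≤-Reasoning

-_ : ℝ → ℝ
- x = mkℝ (λ n → ℚ.- seq x n) λ ε 0<ε →
  let (N , h) = cauchy x ε 0<ε
  in N , λ m n p q → subst (ℚ._< ε)
    (trans (∣p-q∣≡∣q-p∣ (seq x m) (seq x n))
           (cong ℚ.∣_∣ (solve 2 (λ a b → b :- a := (:- a) :- (:- b)) refl (seq x m) (seq x n))))
    (h m n p q)

_-_ : ℝ → ℝ → ℝ
x - y = x + (- y)

∣_∣ : ℝ → ℝ
∣ x ∣ = mkℝ (λ n → ℚ.∣ seq x n ∣) λ ε 0<ε →
  let (N , h) = cauchy x ε 0<ε
  in N , λ m n p q →
    ℚ.≤-<-trans (reverse-triangle (seq x m) (seq x n)) (h m n p q)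

bounded-away : ∀ x → x # 0ℝ →
  Σ[ δ ∈ ℚ ] 0ℚ ℚ.< δ × (Σ[ N ∈ ℕ ] ∀ n → N ℕ.≤ n → δ ℚ.≤ ℚ.∣ seq x n ∣)
bounded-away x (inj₁ (δ , 0<δ , N , h)) = δ , 0<δ , N , λ n p → begin
  δ
    ≡⟨ solve 2 (λ d a → d := (:- a) :+ (a :+ d)) refl δ (seq x n) ⟩
  ℚ.- seq x n ℚ.+ (seq x n ℚ.+ δ)
    ≤⟨ ℚ.+-monoʳ-≤ (ℚ.- seq x n) (h n p) ⟩
  ℚ.- seq x n ℚ.+ 0ℚ
    ≡⟨ ℚ.+-identityʳ (ℚ.- seq x n) ⟩
  ℚ.- seq x n
    ≤⟨ p≤∣p∣ (ℚ.- seq x n) ⟩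
  ℚ.∣ ℚ.- seq x n ∣
    ≡⟨ ℚ.∣-p∣≡∣p∣ (seq x n) ⟩
  ℚ.∣ seq x n ∣ ∎
  where open ℚ.≤-Reasoning
bounded-away x (inj₂ (δ , 0<δ , N , h)) = δ , 0<δ , N , λ n p →
  ℚ.≤-trans (subst (ℚ._≤ seq x n) (ℚ.+-identityˡ δ) (h n p)) (p≤∣p∣ (seq x n))

recip-close : ∀ {δ ε} a b → 0ℚ ℚ.< δ → δ ℚ.≤ ℚ.∣ a ∣ → δ ℚ.≤ ℚ.∣ b ∣ →
  ℚ.∣ a ℚ.- b ∣ ℚ.< ε ℚ.* (δ ℚ.* δ) → ℚ.∣ recip a ℚ.- recip b ∣ ℚ.< ε
recip-close {δ} {ε} a b 0<δ δ≤∣a∣ δ≤∣b∣ ∣a-b∣< =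
  ℚ.*-cancelʳ-<-nonNeg (δ ℚ.* δ) (ℚ.≤-<-trans lower ∣a-b∣<)
  where
  open ℚ.≤-Reasoning

  r : ℚ
  r = recip a ℚ.- recip b

  instance
    δ-pos : ℚ.Positive δ
    δ-pos = ℚ.positive 0<δ
    δ-nonNeg : ℚ.NonNegative δ
    δ-nonNeg = ℚ.pos⇒nonNeg δ
    δδ-nonNeg : ℚ.NonNegative (δ ℚ.* δ)
    δδ-nonNeg = ℚ.nonNeg*nonNeg⇒nonNeg δ δ
    ∣a∣-nonNeg : ℚ.NonNegative ℚ.∣ a ∣
    ∣a∣-nonNeg = ℚ.∣-∣-nonNeg a
    ∣r∣-nonNeg : ℚ.NonNegative ℚ.∣ r ∣
    ∣r∣-nonNeg = ℚ.∣-∣-nonNeg r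

  nonzero : ∀ p → δ ℚ.≤ ℚ.∣ p ∣ → p ≢ 0ℚ
  nonzero p δ≤∣p∣ refl = ℚ.<-irrefl refl (ℚ.<-≤-trans 0<δ δ≤∣p∣)

  lower : ℚ.∣ r ∣ ℚ.* (δ ℚ.* δ) ℚ.≤ ℚ.∣ a ℚ.- b ∣
  lower = begin
    ℚ.∣ r ∣ ℚ.* (δ ℚ.* δ)
      ≤⟨ ℚ.*-monoˡ-≤-nonNeg ℚ.∣ r ∣ (ℚ.≤-trans (ℚ.*-monoʳ-≤-nonNeg δ δ≤∣a∣)
                                                (ℚ.*-monoˡ-≤-nonNeg ℚ.∣ a ∣ δ≤∣b∣)) ⟩
    ℚ.∣ r ∣ ℚ.* (ℚ.∣ a ∣ ℚ.* ℚ.∣ b ∣)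
      ≡⟨ cong (ℚ.∣ r ∣ ℚ.*_) (ℚ.∣p*q∣≡∣p∣*∣q∣ a b) ⟨
    ℚ.∣ r ∣ ℚ.* ℚ.∣ a ℚ.* b ∣
      ≡⟨ ℚ.∣p*q∣≡∣p∣*∣q∣ r (a ℚ.* b) ⟨
    ℚ.∣ r ℚ.* (a ℚ.* b) ∣
      ≡⟨ cong ℚ.∣_∣ (solve 4 (λ s t a b → (s :- t) :* (a :* b) := (s :* a) :* b :- (t :* b) :* a)
           refl (recip a) (recip b) a b) ⟩
    ℚ.∣ (recip a ℚ.* a) ℚ.* b ℚ.- (recip b ℚ.* b) ℚ.* a ∣
      ≡⟨ cong₂ (λ s t → ℚ.∣ s ℚ.* b ℚ.- t ℚ.* a ∣)
           (recip-inverseˡ a (nonzero a δ≤∣a∣)) (recip-inverseˡ b (nonzero b δ≤∣b∣)) ⟩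
    ℚ.∣ 1ℚ ℚ.* b ℚ.- 1ℚ ℚ.* a ∣
      ≡⟨ cong₂ (λ s t → ℚ.∣ s ℚ.- t ∣) (ℚ.*-identityˡ b) (ℚ.*-identityˡ a) ⟩
    ℚ.∣ b ℚ.- a ∣
      ≡⟨ ∣p-q∣≡∣q-p∣ b a ⟩
    ℚ.∣ a ℚ.- b ∣ ∎

-- A sequence apart from 0 is eventually nonzero, so the junk value of
-- recip occurs at finitely many indices only.
inv : (x : ℝ) → x # 0ℝ → ℝ
inv x x#0 = mkℝ (λ n → recip (seq x n)) λ ε 0<ε →
  let (δ , 0<δ , M , away) = bounded-away x x#0
      δδ-pos = ℚ.pos*pos⇒pos δ {{ℚ.positive 0<δ}} δ {{ℚ.positive 0<δ}}
      (N , close) = cauchy x (ε ℚ.* (δ ℚ.* δ))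
        (ℚ.positive⁻¹ _ {{ℚ.pos*pos⇒pos ε {{ℚ.positive 0<ε}} (δ ℚ.* δ) {{δδ-pos}}}})
  in M ℕ.⊔ N , λ m n p q → recip-close (seq x m) (seq x n) 0<δ
       (away m (ℕ.m⊔n≤o⇒m≤o M N p)) (away n (ℕ.m⊔n≤o⇒m≤o M N q))
       (close m n (ℕ.m⊔n≤o⇒n≤o M N p) (ℕ.m⊔n≤o⇒n≤o M N q))

inv-inverseˡ : ∀ x x#0 →
  Σ[ N ∈ ℕ ] ∀ n → N ℕ.≤ n → seq (inv x x#0) n ℚ.* seq x n ≡ 1ℚ
inv-inverseˡ x x#0 =
  let (δ , 0<δ , N , away) = bounded-away x x#0
  in N , λ n p → recip-inverseˡ (seq x n) λ xn≡0 →
       ℚ.<-irrefl refl (ℚ.<-≤-trans 0<δ (subst (λ q → δ ℚ.≤ ℚ.∣ q ∣) xn≡0 (away n p)))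

-- m is the floor of x.  It is a relation because the floor of a real is
-- not computable.
IsFloor : ℝ → ℤ → Set
IsFloor x m = fromℤ m ≤ x × (∀ k → fromℤ k ≤ x → k ℤ.≤ m)

_ConvergesTo_ : (ℕ → ℝ) → ℝ → Set
s ConvergesTo x = ∀ ε → 0ℚ ℚ.< ε →
  Σ[ N ∈ ℕ ] ∀ n → N ℕ.≤ n → ∣ s n - x ∣ < fromℚ ε

partialSum : (ℕ → ℝ) → ℕ → ℝ
partialSum a zero    = 0ℝ
partialSum a (suc N) = partialSum a N + a N

HasSum : (ℕ → ℝ) → ℝ → Set
HasSum a S = partialSum a ConvergesTo S

limit-≤ : ∀ s x y → s ConvergesTo x → s ConvergesTo y → x ≤ y
limit-≤ s x y s→x s→y ε 0<ε =
  let (M , hx) = s→x (halve ε) (halve-pos 0<ε)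
      (N , hy) = s→y (halve ε) (halve-pos 0<ε)
      k = M ℕ.⊔ N
      (δ , 0<δ , M′ , hx′) = hx k (ℕ.m≤m⊔n M N)
      (η , 0<η , N′ , hy′) = hy k (ℕ.m≤n⊔m M N)
  in M′ ℕ.⊔ N′ , λ n p →
    let a = seq x n ; b = seq (s k) n ; c = seq y n in begin
    a
      ≡⟨ solve 2 (λ a c → a := c :+ (a :- c)) refl a c ⟩
    c ℚ.+ (a ℚ.- c)
      ≤⟨ ℚ.+-monoʳ-≤ c (ℚ.≤-trans (p≤∣p∣ (a ℚ.- c)) (triangle a b c)) ⟩
    c ℚ.+ (ℚ.∣ a ℚ.- b ∣ ℚ.+ ℚ.∣ b ℚ.- c ∣)
      ≡⟨ cong (λ r → c ℚ.+ (r ℚ.+ ℚ.∣ b ℚ.- c ∣)) (∣p-q∣≡∣q-p∣ a b) ⟩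
    c ℚ.+ (ℚ.∣ b ℚ.- a ∣ ℚ.+ ℚ.∣ b ℚ.- c ∣)
      ≤⟨ ℚ.+-monoʳ-≤ c (ℚ.+-mono-≤
           (drop ℚ.∣ b ℚ.- a ∣ 0<δ (hx′ n (ℕ.m⊔n≤o⇒m≤o M′ N′ p)))
           (drop ℚ.∣ b ℚ.- c ∣ 0<η (hy′ n (ℕ.m⊔n≤o⇒n≤o M′ N′ p)))) ⟩
    c ℚ.+ (halve ε ℚ.+ halve ε)
      ≡⟨ cong (c ℚ.+_) (halve-sum ε) ⟩
    c ℚ.+ ε ∎
  where open ℚ.≤-Reasoning

HasSum-unique : ∀ a {S T} → HasSum a S → HasSum a T → S ≃ T
HasSum-unique a {S} {T} hS hT =
  limit-≤ (partialSum a) S T hS hT , limit-≤ (partialSum a) T S hT hS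

J : ℕ → ℕ
J 0             = 0
J 1             = 1
J (suc (suc n)) = J (suc n) ℕ.+ 2 ℕ.* J n

J-nonZero : ∀ k .{{_ : ℕ.NonZero k}} → ℕ.NonZero (J k)
J-nonZero 1             = _
J-nonZero (suc (suc k)) = ℕ.>-nonZero
  (ℕ.<-≤-trans (ℕ.>-nonZero⁻¹ (J (suc k)) {{J-nonZero (suc k)}}) (ℕ.m≤m+n _ _))

alternatingReciprocal : ∀ k .{{_ : ℕ.NonZero k}} → ℚ
alternatingReciprocal k = ((-1ℤ ℤ.^ k) ℚ./ J k) {{J-nonZero k}}

-- The terms with index k ≥ n, re-indexed by k = n + i.
alternatingTail : ∀ n .{{_ : ℕ.NonZero n}} → ℕ → ℝ
alternatingTail n i = fromℚ (alternatingReciprocal (n ℕ.+ i)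
  {{ℕ.>-nonZero (ℕ.<-≤-trans (ℕ.>-nonZero⁻¹ n) (ℕ.m≤m+n n i))}})

-- With x_k = (-1/2)^k the term a_k = (-1)^k / J_k equals 3 x_k / (1 - x_k), and
-- 3 x_k = 2 x_k - 2 x_{k+1} telescopes.  For k ≥ n even and z = x_n ≤ 1/4,
--   3 x_k ≤ a_k ≤ 3 x_k + (3 + 4 z) x_k²,
-- and x_k² telescopes as well, which squeezes the sum S between 2z + 3z² and
-- 2z + (4/3)(3 + 4 z) z².  As q = 2^(n-1) = 1 / (2z), this gives q - 1 ≤ 1/S < q.
-- All inequalities are kept with a margin, so that they hold for all partial sums
-- of index beyond 2n; this is what the order on Cauchy reals asks for.

module Submission where

open import Defs hiding (_+_; _-_; -_; _≤_; _<_; ∣_∣)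
open import Algebra.Bundles using (CommutativeRing)
open import Data.Integer as ℤ using (ℤ; +_; 1ℤ; -1ℤ)
open import Data.Nat as ℕ using (ℕ; zero; suc; NonZero)
open import Data.Nat.Divisibility using (_∣_; divides)
open import Data.Product using (Σ-syntax; _×_; _,_)
open import Data.Rational as ℚ using (ℚ; 0ℚ; 1ℚ; ½; -½; _/_; _+_; _*_; _-_; -_; ∣_∣; _≤_; _<_)
open import Data.Rational.Solver using (module +-*-Solver)
open import Data.Sum using (_⊎_; inj₁; inj₂)
open import Function using (_∘_)
open import Relation.Binary.PropositionalEquality using (_≡_; refl; sym; trans; cong; cong₂; subst; module ≡-Reasoning)
open import Relation.Nullary using (yes; no; contradiction)
import Algebra.Properties.Semiring.Exp as Exp
import Data.Integer.Properties as ℤ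
import Data.Integer.Solver as ℤSolver
import Data.Nat.Properties as ℕ
import Data.Rational.Properties as ℚ
import Data.Rational.Unnormalised as ℚᵘ
import Data.Rational.Unnormalised.Properties as ℚᵘ

open +-*-Solver using (solve; con; _:=_; _:+_; _:*_; _:-_; :-_)
open Exp (CommutativeRing.semiring ℚ.+-*-commutativeRing) using (_^_; ^-homo-*)

-- Rational arithmetic

-1ℚ ¼ 2ℚ 3ℚ 4ℚ 8ℚ 4/3 : ℚ
-1ℚ = - 1ℚ
¼ = + 1 / 4
2ℚ = + 2 / 1
3ℚ = + 3 / 1
4ℚ = + 4 / 1
8ℚ = + 8 / 1
4/3 = + 4 / 3

0≤+ : ∀ {p q} → 0ℚ ≤ p → 0ℚ ≤ q → 0ℚ ≤ p + q
0≤+ = ℚ.+-mono-≤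

0≤* : ∀ {p q} → 0ℚ ≤ p → 0ℚ ≤ q → 0ℚ ≤ p * q
0≤* {p} {q} 0≤p 0≤q = ℚ.nonNegative⁻¹ (p * q)
  {{ℚ.nonNeg*nonNeg⇒nonNeg p {{ℚ.nonNegative 0≤p}} q {{ℚ.nonNegative 0≤q}}}}

0<* : ∀ {p q} → 0ℚ < p → 0ℚ < q → 0ℚ < p * q
0<* {p} {q} 0<p 0<q = ℚ.positive⁻¹ (p * q)
  {{ℚ.pos*pos⇒pos p {{ℚ.positive 0<p}} q {{ℚ.positive 0<q}}}}

p≤q⇒0≤q-p : ∀ {p q} → p ≤ q → 0ℚ ≤ q - p
p≤q⇒0≤q-p {p} {q} p≤q = subst (_≤ q - p) (ℚ.+-inverseʳ p) (ℚ.+-monoˡ-≤ (- p) p≤q)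

-- The form in which most inequalities below are proved: `r` is an explicit slack, written as a sum
-- of products of nonnegative factors, and the ring solver checks the identity.
0≤r∧q≡p+r⇒p≤q : ∀ {p q} r → 0ℚ ≤ r → q ≡ p + r → p ≤ q
0≤r∧q≡p+r⇒p≤q {p} r 0≤r refl = subst (_≤ p + r) (ℚ.+-identityʳ p) (ℚ.+-monoʳ-≤ p 0≤r)

*-cancelʳ-≤ : ∀ {p q r} → 0ℚ < r → p * r ≤ q * r → p ≤ q
*-cancelʳ-≤ {r = r} 0<r = ℚ.*-cancelʳ-≤-pos r {{ℚ.positive 0<r}}

p≤q∧-p≤q⇒∣p∣≤q : ∀ {p q} → p ≤ q → - p ≤ q → ∣ p ∣ ≤ q
p≤q∧-p≤q⇒∣p∣≤q {p} p≤q -p≤q with ℚ.∣p∣≡p∨∣p∣≡-p p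
... | inj₁ eq = subst (_≤ _) (sym eq) p≤q
... | inj₂ eq = subst (_≤ _) (sym eq) -p≤q

-- The embedding of the integers

ι : ℤ → ℚ
ι i = i / 1

-- Arithmetic on `ℚ` reduces to lowest terms and blocks on variables; unnormalised fractions are
-- compared by cross products, so the identity is settled there.
fromℚᵘ-homo-* : ∀ p q → ℚ.fromℚᵘ p * ℚ.fromℚᵘ q ≡ ℚ.fromℚᵘ (p ℚᵘ.* q)
fromℚᵘ-homo-* p q = ℚ.toℚᵘ-injective (begin
  ℚ.toℚᵘ (ℚ.fromℚᵘ p * ℚ.fromℚᵘ q)
    ≈⟨ ℚ.toℚᵘ-homo-* (ℚ.fromℚᵘ p) (ℚ.fromℚᵘ q) ⟩
  ℚ.toℚᵘ (ℚ.fromℚᵘ p) ℚᵘ.* ℚ.toℚᵘ (ℚ.fromℚᵘ q)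
    ≈⟨ ℚᵘ.*-cong (ℚ.toℚᵘ-fromℚᵘ p) (ℚ.toℚᵘ-fromℚᵘ q) ⟩
  p ℚᵘ.* q
    ≈⟨ ℚ.toℚᵘ-fromℚᵘ (p ℚᵘ.* q) ⟨
  ℚ.toℚᵘ (ℚ.fromℚᵘ (p ℚᵘ.* q)) ∎)
  where open import Relation.Binary.Reasoning.Setoid ℚᵘ.≃-setoid

fromℚᵘ-homo-+ : ∀ p q → ℚ.fromℚᵘ p + ℚ.fromℚᵘ q ≡ ℚ.fromℚᵘ (p ℚᵘ.+ q)
fromℚᵘ-homo-+ p q = ℚ.toℚᵘ-injective (begin
  ℚ.toℚᵘ (ℚ.fromℚᵘ p + ℚ.fromℚᵘ q)
    ≈⟨ ℚ.toℚᵘ-homo-+ (ℚ.fromℚᵘ p) (ℚ.fromℚᵘ q) ⟩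
  ℚ.toℚᵘ (ℚ.fromℚᵘ p) ℚᵘ.+ ℚ.toℚᵘ (ℚ.fromℚᵘ q)
    ≈⟨ ℚᵘ.+-cong (ℚ.toℚᵘ-fromℚᵘ p) (ℚ.toℚᵘ-fromℚᵘ q) ⟩
  p ℚᵘ.+ q
    ≈⟨ ℚ.toℚᵘ-fromℚᵘ (p ℚᵘ.+ q) ⟨
  ℚ.toℚᵘ (ℚ.fromℚᵘ (p ℚᵘ.+ q)) ∎)
  where open import Relation.Binary.Reasoning.Setoid ℚᵘ.≃-setoid

ι-homo-* : ∀ i j → ι (i ℤ.* j) ≡ ι i * ι j
ι-homo-* i j = sym (fromℚᵘ-homo-* (i ℚᵘ./ 1) (j ℚᵘ./ 1))

ι-homo-+ : ∀ i j → ι (i ℤ.+ j) ≡ ι i + ι j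
-- Unnormalised addition over the denominator 1 leaves the numerator i * 1 + j * 1.
ι-homo-+ i j = sym (trans (fromℚᵘ-homo-+ (i ℚᵘ./ 1) (j ℚᵘ./ 1))
  (cong ι (cong₂ ℤ._+_ (ℤ.*-identityʳ i) (ℤ.*-identityʳ j))))

ι-nonNeg : ∀ {i} → ℤ.0ℤ ℤ.≤ i → 0ℚ ≤ ι i
ι-nonNeg {+ n} (ℤ.+≤+ _) = ℚ.nonNegative⁻¹ (ι (+ n)) {{ℚ.normalize-nonNeg n 1}}

ι-mono-≤ : ∀ {i j} → i ℤ.≤ j → ι i ≤ ι j
ι-mono-≤ {i} {j} i≤j = 0≤r∧q≡p+r⇒p≤q (ι (j ℤ.- i)) (ι-nonNeg (ℤ.i≤j⇒0≤j-i i≤j))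
  (trans (cong ι (ℤSolver.+-*-Solver.solve 2 (λ i j → j S.:= i S.:+ (j S.:- i)) refl i j))
         (ι-homo-+ i (j ℤ.- i)))
  where module S = ℤSolver.+-*-Solver

/-*-cancel : ∀ i d .{{_ : NonZero d}} → (i / d) * ι (+ d) ≡ ι i
/-*-cancel i d@(suc _) = trans (fromℚᵘ-homo-* (i ℚᵘ./ d) (+ d ℚᵘ./ 1))
  (ℚ.fromℚᵘ-cong {(i ℚᵘ./ d) ℚᵘ.* (+ d ℚᵘ./ 1)} {i ℚᵘ./ 1} (ℚᵘ.*≡* (ℤ.*-assoc i (+ d) (+ 1))))

-- Powers of ½ and -½

½^-pos : ∀ k → 0ℚ < ½ ^ k
½^-pos zero    = ℚ.positive⁻¹ 1ℚ
½^-pos (suc k) = 0<* (ℚ.positive⁻¹ ½) (½^-pos k)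

½^-nonNeg : ∀ k → 0ℚ ≤ ½ ^ k
½^-nonNeg k = ℚ.<⇒≤ (½^-pos k)

½^-≤1 : ∀ k → ½ ^ k ≤ 1ℚ
½^-≤1 zero    = ℚ.≤-refl
½^-≤1 (suc k) = ℚ.≤-trans
  (0≤r∧q≡p+r⇒p≤q (½ * ½ ^ k) (0≤* (ℚ.nonNegative⁻¹ ½) (½^-nonNeg k))
    (solve 1 (λ w → w := con ½ :* w :+ con ½ :* w) refl (½ ^ k)))
  (½^-≤1 k)

½^-antimono : ∀ {k m} → k ℕ.≤ m → ½ ^ m ≤ ½ ^ k
½^-antimono {k} {m} k≤m = subst (_≤ ½ ^ k)
  (trans (sym (^-homo-* ½ k (m ℕ.∸ k))) (cong (½ ^_) (ℕ.m+[n∸m]≡n k≤m)))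
  (0≤r∧q≡p+r⇒p≤q (½ ^ k * (1ℚ - v)) (0≤* (½^-nonNeg k) (p≤q⇒0≤q-p (½^-≤1 (m ℕ.∸ k))))
    (solve 2 (λ w v → w := w :* v :+ w :* (con 1ℚ :- v)) refl (½ ^ k) v))
  where
  v : ℚ
  v = ½ ^ (m ℕ.∸ k)

½^*2^≡1 : ∀ k → ½ ^ k * ι (+ (2 ℕ.^ k)) ≡ 1ℚ
½^*2^≡1 zero    = refl
½^*2^≡1 (suc k) = begin
  (½ * ½ ^ k) * ι (+ (2 ℕ.^ suc k))
    ≡⟨ cong (λ i → (½ * ½ ^ k) * ι i) (ℤ.pos-* 2 (2 ℕ.^ k)) ⟩
  (½ * ½ ^ k) * ι (+ 2 ℤ.* + (2 ℕ.^ k))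
    ≡⟨ cong ((½ * ½ ^ k) *_) (ι-homo-* (+ 2) (+ (2 ℕ.^ k))) ⟩
  (½ * ½ ^ k) * (2ℚ * ι (+ (2 ℕ.^ k)))
    ≡⟨ solve 2 (λ w q → (con ½ :* w) :* (con 2ℚ :* q) := w :* q) refl (½ ^ k) (ι (+ (2 ℕ.^ k))) ⟩
  ½ ^ k * ι (+ (2 ℕ.^ k))
    ≡⟨ ½^*2^≡1 k ⟩
  1ℚ ∎
  where open ≡-Reasoning

-- Together with the next bound this is |(-½)^k| ≤ ½^k. The two are proved by mutual induction,
-- because a factor -½ exchanges them.
-½^≤½^ : ∀ k → -½ ^ k ≤ ½ ^ k
-[-½^]≤½^ : ∀ k → - (-½ ^ k) ≤ ½ ^ k
-½^≤½^ zero    = ℚ.≤-refl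
-½^≤½^ (suc k) = 0≤r∧q≡p+r⇒p≤q (½ * (w - - u))
  (0≤* (ℚ.nonNegative⁻¹ ½) (p≤q⇒0≤q-p (-[-½^]≤½^ k)))
  (solve 2 (λ w u → con ½ :* w := con -½ :* u :+ con ½ :* (w :- (:- u))) refl w u)
  where
  w u : ℚ
  w = ½ ^ k
  u = -½ ^ k
-[-½^]≤½^ zero    = ℚ.<⇒≤ (ℚ.neg<pos -1ℚ 1ℚ)
-[-½^]≤½^ (suc k) = 0≤r∧q≡p+r⇒p≤q (½ * (w - u))
  (0≤* (ℚ.nonNegative⁻¹ ½) (p≤q⇒0≤q-p (-½^≤½^ k)))
  (solve 2 (λ w u → con ½ :* w := :- (con -½ :* u) :+ con ½ :* (w :- u)) refl w u)
  where
  w u : ℚ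
  w = ½ ^ k
  u = -½ ^ k

-½^-even : ∀ m → -½ ^ (m ℕ.* 2) ≡ ½ ^ (m ℕ.* 2)
-½^-even zero    = refl
-½^-even (suc m) = trans (cong (λ u → -½ * (-½ * u)) (-½^-even m))
  (solve 1 (λ w → con -½ :* (con -½ :* w) := con ½ :* (con ½ :* w)) refl (½ ^ (m ℕ.* 2)))

-- A positive ε is at least 1 / d for its denominator d, and ½ ^ m ≤ 1 / m.
½^-null : ∀ {ε} → 0ℚ < ε → Σ[ N ∈ ℕ ] ∀ m → N ℕ.≤ m → ½ ^ m ≤ ε
½^-null {ε@(ℚ.mkℚ i d-1 _)} 0<ε = d , λ m d≤m → *-cancelʳ-≤ 0<d (begin
  ½ ^ m * ι (+ d)        ≤⟨ *-mono (½^-nonNeg m) (ι-mono-≤ (ℤ.+≤+ d≤m)) ⟩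
  ½ ^ m * ι (+ m)        ≤⟨ ½^*≤1 m ⟩
  1ℚ                     ≤⟨ ι-mono-≤ (pos⇒1≤ (ℚ.positive 0<ε)) ⟩
  ι i                    ≡⟨ ε*d ⟨
  ε * ι (+ d)            ∎)
  where
  open ℚ.≤-Reasoning
  d : ℕ
  d = suc d-1
  0<d : 0ℚ < ι (+ d)
  0<d = ℚ.positive⁻¹ (ι (+ d)) {{ℚ.normalize-pos d 1}}
  ε*d : ε * ι (+ d) ≡ ι i
  ε*d = trans (cong (_* ι (+ d)) (sym (ℚ.↥p/↧p≡p ε))) (/-*-cancel i d)
  pos⇒1≤ : ∀ {i} → ℤ.Positive i → + 1 ℤ.≤ i
  pos⇒1≤ {+ suc _} _ = ℤ.+≤+ (ℕ.s≤s ℕ.z≤n)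
  *-mono : ∀ {p q r} → 0ℚ ≤ p → q ≤ r → p * q ≤ p * r
  *-mono {p} 0≤p = ℚ.*-monoˡ-≤-nonNeg p {{ℚ.nonNegative 0≤p}}
  ½^*≤1 : ∀ m → ½ ^ m * ι (+ m) ≤ 1ℚ
  ½^*≤1 m = begin
    ½ ^ m * ι (+ m)            ≤⟨ *-mono (½^-nonNeg m) (ι-mono-≤ (ℤ.+≤+ (ℕ.<⇒≤ (m<2^m m)))) ⟩
    ½ ^ m * ι (+ (2 ℕ.^ m))    ≡⟨ ½^*2^≡1 m ⟩
    1ℚ                         ∎
    where
    m<2^m : ∀ m → m ℕ.< 2 ℕ.^ m
    m<2^m zero    = ℕ.s≤s ℕ.z≤n
    m<2^m (suc m) = ℕ.+-mono-≤ (ℕ.>-nonZero⁻¹ (2 ℕ.^ m) {{ℕ.m^n≢0 2 m}})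
      (ℕ.≤-trans (m<2^m m) (ℕ.m≤m+n (2 ℕ.^ m) 0))

-- Jacobsthal numbers and their alternating reciprocals

-- The closed form 3 J_k = 2^k - (-1)^k, multiplied by (-1)^k (-½)^k.
Jacobsthal-closed : ∀ k → 3ℚ * ((-1ℚ ^ k) * ι (+ J k)) * -½ ^ k ≡ 1ℚ - -½ ^ k
Jacobsthal-closed 0 = refl
Jacobsthal-closed 1 = refl
Jacobsthal-closed (suc (suc k)) = begin
  3ℚ * ((-1ℚ * (-1ℚ * s)) * ι (+ J (suc (suc k)))) * (-½ * (-½ * x))
    ≡⟨ cong (λ j → 3ℚ * ((-1ℚ * (-1ℚ * s)) * j) * (-½ * (-½ * x))) J-step ⟩
  3ℚ * ((-1ℚ * (-1ℚ * s)) * (j₁ + 2ℚ * j₀)) * (-½ * (-½ * x))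
    -- The weight ½^k turns the recurrence into u_{k+2} = ½ u_{k+1} + ½ u_k, which 1 - (-½)^k
    -- satisfies too.
    ≡⟨ solve 4 (λ s j₀ j₁ x →
         con 3ℚ :* ((con -1ℚ :* (con -1ℚ :* s)) :* (j₁ :+ con 2ℚ :* j₀)) :* (con -½ :* (con -½ :* x)) :=
         con ½ :* (con 3ℚ :* ((con -1ℚ :* s) :* j₁) :* (con -½ :* x)) :+ con ½ :* (con 3ℚ :* (s :* j₀) :* x))
         refl s j₀ j₁ x ⟩
  ½ * (3ℚ * ((-1ℚ * s) * j₁) * (-½ * x)) + ½ * (3ℚ * (s * j₀) * x)
    ≡⟨ cong₂ (λ a b → ½ * a + ½ * b) (Jacobsthal-closed (suc k)) (Jacobsthal-closed k) ⟩
  ½ * (1ℚ - -½ * x) + ½ * (1ℚ - x)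
    ≡⟨ solve 1 (λ x → con ½ :* (con 1ℚ :- con -½ :* x) :+ con ½ :* (con 1ℚ :- x) :=
                      con 1ℚ :- con -½ :* (con -½ :* x)) refl x ⟩
  1ℚ - -½ * (-½ * x) ∎
  where
  open ≡-Reasoning
  s x j₀ j₁ : ℚ
  s = -1ℚ ^ k
  x = -½ ^ k
  j₀ = ι (+ J k)
  j₁ = ι (+ J (suc k))
  J-step : ι (+ J (suc (suc k))) ≡ j₁ + 2ℚ * j₀
  J-step = trans (ι-homo-+ (+ J (suc k)) (+ (2 ℕ.* J k)))
    (cong (λ r → j₁ + r) (trans (cong ι (ℤ.pos-* 2 (J k))) (ι-homo-* (+ 2) (+ J k))))

ι-[-1]^ : ∀ k → ι (-1ℤ ℤ.^ k) ≡ -1ℚ ^ k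
ι-[-1]^ zero    = refl
ι-[-1]^ (suc k) = trans (ι-homo-* -1ℤ (-1ℤ ℤ.^ k)) (cong (-1ℚ *_) (ι-[-1]^ k))

[-1]^-square : ∀ k → (-1ℚ ^ k) * (-1ℚ ^ k) ≡ 1ℚ
[-1]^-square zero    = refl
[-1]^-square (suc k) = trans
  (solve 1 (λ s → (con -1ℚ :* s) :* (con -1ℚ :* s) := s :* s) refl (-1ℚ ^ k)) ([-1]^-square k)

-- This is a_k = 3 x_k / (1 - x_k) without division. Once 1 - x is replaced by the closed form, J_k
-- cancels against the denominator of a_k, and the two signs (-1)^k multiply to 1.
alternatingReciprocal-closed : ∀ k .{{_ : NonZero k}} →
  alternatingReciprocal k * (1ℚ - -½ ^ k) ≡ 3ℚ * -½ ^ k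
alternatingReciprocal-closed k = begin
  a * (1ℚ - x)               ≡⟨ cong (a *_) (Jacobsthal-closed k) ⟨
  a * (3ℚ * (s * j) * x)     ≡⟨ solve 4 (λ a s j x → a :* (con 3ℚ :* (s :* j) :* x) := con 3ℚ :* x :* (s :* (a :* j))) refl a s j x ⟩
  3ℚ * x * (s * (a * j))     ≡⟨ cong (λ r → 3ℚ * x * (s * r)) (trans (/-*-cancel (-1ℤ ℤ.^ k) (J k) {{J-nonZero k}}) (ι-[-1]^ k)) ⟩
  3ℚ * x * (s * s)           ≡⟨ cong (3ℚ * x *_) ([-1]^-square k) ⟩
  3ℚ * x * 1ℚ                ≡⟨ ℚ.*-identityʳ (3ℚ * x) ⟩
  3ℚ * x                     ∎
  where
  open ≡-Reasoning
  a x s j : ℚ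
  a = alternatingReciprocal k
  x = -½ ^ k
  s = -1ℚ ^ k
  j = ι (+ J k)

-- Series of rationals

sumTo : (ℕ → ℚ) → ℕ → ℚ
sumTo f zero    = 0ℚ
sumTo f (suc N) = sumTo f N + f N

seq-partialSum : ∀ f N j → seq (partialSum (fromℚ ∘ f) N) j ≡ sumTo f N
seq-partialSum f zero    j = refl
seq-partialSum f (suc N) j = cong (_+ f N) (seq-partialSum f N j)

module _ (f β : ℕ → ℚ) (f-bound : ∀ i → ∣ f i ∣ ≤ β i - β (suc i)) where

  -- By the triangle inequality the terms are summed in absolute value, and their majorants β i - β
  -- (i + 1) telescope.
  sumTo-dist : ∀ m d → ∣ sumTo f (d ℕ.+ m) - sumTo f m ∣ ≤ β m - β (d ℕ.+ m)
  sumTo-dist m zero = ℚ.≤-reflexive (trans (cong ∣_∣ (ℚ.+-inverseʳ (sumTo f m))) (sym (ℚ.+-inverseʳ (β m))))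
  sumTo-dist m (suc d) = begin
    ∣ (P′ + f k) - P ∣               ≡⟨ cong ∣_∣ (solve 3 (λ a b c → (a :+ b) :- c := (a :- c) :+ b) refl P′ (f k) P) ⟩
    ∣ (P′ - P) + f k ∣               ≤⟨ ℚ.∣p+q∣≤∣p∣+∣q∣ (P′ - P) (f k) ⟩
    ∣ P′ - P ∣ + ∣ f k ∣             ≤⟨ ℚ.+-mono-≤ (sumTo-dist m d) (f-bound k) ⟩
    (β m - β k) + (β k - β (suc k))  ≡⟨ solve 3 (λ a b c → (a :- b) :+ (b :- c) := a :- c) refl (β m) (β k) (β (suc k)) ⟩
    β m - β (suc k)                  ∎
    where
    open ℚ.≤-Reasoning
    k : ℕ
    k = d ℕ.+ m
    P P′ : ℚ
    P = sumTo f m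
    P′ = sumTo f k

  module _ (0≤β : ∀ i → 0ℚ ≤ β i)
           (β-null : ∀ {ε} → 0ℚ < ε → Σ[ N ∈ ℕ ] ∀ m → N ℕ.≤ m → β m < ε) where

    sumTo-dist-≤ : ∀ {m n} → m ℕ.≤ n → ∣ sumTo f n - sumTo f m ∣ ≤ β m
    sumTo-dist-≤ {m} {n} m≤n = begin
      ∣ sumTo f n - sumTo f m ∣                   ≡⟨ cong (λ k → ∣ sumTo f k - sumTo f m ∣) (ℕ.m∸n+n≡m m≤n) ⟨
      ∣ sumTo f (n ℕ.∸ m ℕ.+ m) - sumTo f m ∣     ≤⟨ sumTo-dist m (n ℕ.∸ m) ⟩
      β m - β (n ℕ.∸ m ℕ.+ m)                     ≤⟨ 0≤r∧q≡p+r⇒p≤q (β (n ℕ.∸ m ℕ.+ m)) (0≤β _)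
                                                       (solve 2 (λ a b → a := (a :- b) :+ b) refl (β m) _) ⟩
      β m                                         ∎
      where open ℚ.≤-Reasoning

    sumTo-cauchy : Cauchy (sumTo f)
    sumTo-cauchy ε 0<ε = let (N , small) = β-null 0<ε in N , λ m n N≤m N≤n → close small N≤m N≤n (ℕ.≤-total m n)
      where
      close : ∀ {N m n} → (∀ m → N ℕ.≤ m → β m < ε) → N ℕ.≤ m → N ℕ.≤ n →
        m ℕ.≤ n ⊎ n ℕ.≤ m → ∣ sumTo f m - sumTo f n ∣ < ε
      close {_} {m} {n} small N≤m N≤n (inj₁ m≤n) = subst (_< ε) (∣p-q∣≡∣q-p∣ (sumTo f n) (sumTo f m))
        (ℚ.≤-<-trans (sumTo-dist-≤ m≤n) (small m N≤m))
      close {_} {m} {n} small N≤m N≤n (inj₂ n≤m) = ℚ.≤-<-trans (sumTo-dist-≤ n≤m) (small n N≤n)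

-- Each partial sum is a constant sequence, so its distance to the limit at index j is that of two
-- values of `sumTo f`. Half of ε bounds this distance; the other half is the margin that strict
-- order on reals demands.
HasSum-sumTo : ∀ f (c : Cauchy (sumTo f)) → HasSum (fromℚ ∘ f) (mkℝ (sumTo f) c)
HasSum-sumTo f c ε 0<ε =
  let (N , close) = c (halve ε) (halve-pos 0<ε)
  in N , λ n N≤n → halve ε , halve-pos 0<ε , N , λ j N≤j → begin
    ∣ seq (partialSum (fromℚ ∘ f) n) j - sumTo f j ∣ + halve ε
      ≡⟨ cong (λ p → ∣ p - sumTo f j ∣ + halve ε) (seq-partialSum f n j) ⟩
    ∣ sumTo f n - sumTo f j ∣ + halve ε
      ≤⟨ ℚ.+-monoˡ-≤ (halve ε) (ℚ.<⇒≤ (close n j N≤n N≤j)) ⟩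
    halve ε + halve ε
      ≡⟨ halve-sum ε ⟩
    ε ∎
  where open ℚ.≤-Reasoning

0≤p*p : ∀ p → 0ℚ ≤ p * p
0≤p*p p with ℚ.≤-total 0ℚ p
... | inj₁ 0≤p = 0≤* 0≤p 0≤p
... | inj₂ p≤0 = subst (0ℚ ≤_) (solve 1 (λ p → (:- p) :* (:- p) := p :* p) refl p)
  (0≤* (ℚ.neg-antimono-≤ p≤0) (ℚ.neg-antimono-≤ p≤0))

-- Bounds for a = 3x / (1 - x) and its alternating sums

module _ (a x : ℚ) (closed : a * (1ℚ - x) ≡ 3ℚ * x) where

  -- After multiplication by 1 - x > 0 the right side becomes 3x by `closed`, and the slack is 3x².
  3x≤a : 0ℚ < 1ℚ - x → 3ℚ * x ≤ a
  3x≤a 0<1-x = *-cancelʳ-≤ 0<1-x (0≤r∧q≡p+r⇒p≤q (3ℚ * (x * x))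
    (0≤* (ℚ.nonNegative⁻¹ 3ℚ) (0≤p*p x))
    (trans closed (solve 1 (λ x → con 3ℚ :* x := con 3ℚ :* x :* (con 1ℚ :- x) :+ con 3ℚ :* (x :* x)) refl x)))

  -- One more term of the geometric expansion of 3x / (1 - x); the slack 3x³ is nonnegative as x is.
  3x+3x²≤a : 0ℚ < 1ℚ - x → 0ℚ ≤ x → 3ℚ * x + 3ℚ * (x * x) ≤ a
  3x+3x²≤a 0<1-x 0≤x = *-cancelʳ-≤ 0<1-x (0≤r∧q≡p+r⇒p≤q (3ℚ * (x * (x * x)))
    (0≤* (ℚ.nonNegative⁻¹ 3ℚ) (0≤* 0≤x (0≤p*p x)))
    (trans closed (solve 1 (λ x → con 3ℚ :* x := (con 3ℚ :* x :+ con 3ℚ :* (x :* x)) :* (con 1ℚ :- x)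
      :+ con 3ℚ :* (x :* (x :* x))) refl x)))

  -- The remainder of 3x / (1 - x) after 3x is x² · 3 / (1 - x), so any c above 3 / (1 - x) will do.
  a≤3x+cx² : ∀ {c} → 0ℚ < 1ℚ - x → 3ℚ ≤ c * (1ℚ - x) → a ≤ 3ℚ * x + c * (x * x)
  a≤3x+cx² {c} 0<1-x 3≤c[1-x] = *-cancelʳ-≤ 0<1-x (0≤r∧q≡p+r⇒p≤q ((x * x) * (c * (1ℚ - x) - 3ℚ))
    (0≤* (0≤p*p x) (p≤q⇒0≤q-p 3≤c[1-x]))
    (trans (solve 2 (λ c x → (con 3ℚ :* x :+ c :* (x :* x)) :* (con 1ℚ :- x) :=
                       con 3ℚ :* x :+ (x :* x) :* (c :* (con 1ℚ :- x) :- con 3ℚ)) refl c x)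
           (cong (_+ (x * x) * (c * (1ℚ - x) - 3ℚ)) (sym closed))))

  ∣a∣≤4∣x∣ : x ≤ ¼ → ∣ a ∣ ≤ 4ℚ * ∣ x ∣
  ∣a∣≤4∣x∣ x≤¼ = *-cancelʳ-≤ 0<3/4 (begin
    ∣ a ∣ * (1ℚ - ¼)       ≤⟨ ℚ.*-monoˡ-≤-nonNeg ∣ a ∣ {{ℚ.∣-∣-nonNeg a}} 3/4≤1-x ⟩
    ∣ a ∣ * (1ℚ - x)       ≡⟨ cong (∣ a ∣ *_) (ℚ.0≤p⇒∣p∣≡p (ℚ.≤-trans (ℚ.<⇒≤ 0<3/4) 3/4≤1-x)) ⟨
    ∣ a ∣ * ∣ 1ℚ - x ∣     ≡⟨ ℚ.∣p*q∣≡∣p∣*∣q∣ a (1ℚ - x) ⟨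
    ∣ a * (1ℚ - x) ∣       ≡⟨ cong ∣_∣ closed ⟩
    ∣ 3ℚ * x ∣             ≡⟨ ℚ.∣p*q∣≡∣p∣*∣q∣ 3ℚ x ⟩
    3ℚ * ∣ x ∣             ≡⟨ solve 1 (λ x → con 3ℚ :* x := con 4ℚ :* x :* (con 1ℚ :- con ¼)) refl ∣ x ∣ ⟩
    4ℚ * ∣ x ∣ * (1ℚ - ¼)  ∎)
    where
    open ℚ.≤-Reasoning
    0<3/4 : 0ℚ < 1ℚ - ¼
    0<3/4 = ℚ.positive⁻¹ (1ℚ - ¼)
    3/4≤1-x : 1ℚ - ¼ ≤ 1ℚ - x
    3/4≤1-x = ℚ.+-monoʳ-≤ 1ℚ (ℚ.neg-antimono-≤ x≤¼)

-- Convergence and two-sided bounds for the partial sums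

module TailBounds (f : ℕ → ℚ) (z : ℚ) (0<z : 0ℚ < z) (z≤¼ : z ≤ ¼)
  (closed : ∀ i → f i * (1ℚ - z * -½ ^ i) ≡ 3ℚ * (z * -½ ^ i)) where

  x : ℕ → ℚ
  x i = z * -½ ^ i

  0≤z : 0ℚ ≤ z
  0≤z = ℚ.<⇒≤ 0<z

  x₀≡z : x 0 ≡ z
  x₀≡z = ℚ.*-identityʳ z

  x-step : ∀ i → x (suc i) ≡ -½ * x i
  x-step i = solve 2 (λ z u → z :* (con -½ :* u) := con -½ :* (z :* u)) refl z (-½ ^ i)

  x≤z½^ : ∀ i → x i ≤ z * ½ ^ i
  x≤z½^ i = ℚ.*-monoˡ-≤-nonNeg z {{ℚ.nonNegative 0≤z}} (-½^≤½^ i)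

  -x≤z½^ : ∀ i → - x i ≤ z * ½ ^ i
  -x≤z½^ i = subst (_≤ z * ½ ^ i) (sym (ℚ.neg-distribʳ-* z (-½ ^ i)))
    (ℚ.*-monoˡ-≤-nonNeg z {{ℚ.nonNegative 0≤z}} (-[-½^]≤½^ i))

  x≤z : ∀ i → x i ≤ z
  x≤z i = ℚ.≤-trans (x≤z½^ i)
    (subst (z * ½ ^ i ≤_) (ℚ.*-identityʳ z) (ℚ.*-monoˡ-≤-nonNeg z {{ℚ.nonNegative 0≤z}} (½^-≤1 i)))

  p≤¼⇒0<1-p : ∀ {p} → p ≤ ¼ → 0ℚ < 1ℚ - p
  p≤¼⇒0<1-p p≤¼ = ℚ.<-≤-trans (ℚ.positive⁻¹ (1ℚ - ¼)) (ℚ.+-monoʳ-≤ 1ℚ (ℚ.neg-antimono-≤ p≤¼))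

  0<1-x : ∀ i → 0ℚ < 1ℚ - x i
  0<1-x i = p≤¼⇒0<1-p (ℚ.≤-trans (x≤z i) z≤¼)

  -- Twice the bound 4 z ½^i on the i-th term, because a geometric tail of ratio ½ sums to twice its
  -- first term.
  β : ℕ → ℚ
  β i = 8ℚ * (z * ½ ^ i)

  0≤β : ∀ i → 0ℚ ≤ β i
  0≤β i = 0≤* (ℚ.nonNegative⁻¹ 8ℚ) (0≤* 0≤z (½^-nonNeg i))

  f-bound : ∀ i → ∣ f i ∣ ≤ β i - β (suc i)
  f-bound i = begin
    ∣ f i ∣            ≤⟨ ∣a∣≤4∣x∣ (f i) (x i) (closed i) (ℚ.≤-trans (x≤z i) z≤¼) ⟩
    4ℚ * ∣ x i ∣       ≤⟨ ℚ.*-monoˡ-≤-nonNeg 4ℚ (p≤q∧-p≤q⇒∣p∣≤q (x≤z½^ i) (-x≤z½^ i)) ⟩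
    4ℚ * (z * ½ ^ i)   ≡⟨ solve 2 (λ z w → con 4ℚ :* (z :* w) :=
                            con 8ℚ :* (z :* w) :- con 8ℚ :* (z :* (con ½ :* w))) refl z (½ ^ i) ⟩
    β i - β (suc i)    ∎
    where open ℚ.≤-Reasoning

  β-null : ∀ {ε} → 0ℚ < ε → Σ[ N ∈ ℕ ] ∀ m → N ℕ.≤ m → β m < ε
  -- With z ≤ ¼ and ½^m ≤ ε / 4 the value 8 z ½^m is at most ε / 2, hence strictly below ε.
  β-null {ε} 0<ε = let (N , small) = ½^-null 0<ε/4 in N , λ m N≤m → begin-strict
    8ℚ * (z * ½ ^ m)   ≤⟨ ℚ.*-monoˡ-≤-nonNeg 8ℚ (ℚ.*-monoʳ-≤-nonNeg (½ ^ m) {{ℚ.nonNegative (½^-nonNeg m)}} z≤¼) ⟩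
    8ℚ * (¼ * ½ ^ m)   ≤⟨ ℚ.*-monoˡ-≤-nonNeg 8ℚ (ℚ.*-monoˡ-≤-nonNeg ¼ (small m N≤m)) ⟩
    8ℚ * (¼ * (¼ * ε)) ≡⟨ solve 1 (λ e → con 8ℚ :* (con ¼ :* (con ¼ :* e)) := con 0ℚ :+ con ½ :* e) refl ε ⟩
    0ℚ + halve ε       <⟨ ℚ.+-monoˡ-< (halve ε) (halve-pos 0<ε) ⟩
    halve ε + halve ε  ≡⟨ halve-sum ε ⟩
    ε                  ∎
    where
    open ℚ.≤-Reasoning
    0<ε/4 : 0ℚ < ¼ * ε
    0<ε/4 = 0<* (ℚ.positive⁻¹ ¼) 0<ε

  cauchy-f : Cauchy (sumTo f)
  cauchy-f = sumTo-cauchy f β f-bound 0≤β β-null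

  -- 3 / (1 - z) ≤ 3 + 4 z because z ≤ ¼.
  c : ℚ
  c = 3ℚ + 4ℚ * z

  3≤c[1-x] : ∀ i → 3ℚ ≤ c * (1ℚ - x i)
  -- The slack is the one at x = z, namely 4 z (¼ - z), plus the gain c (z - x) from a smaller x.
  3≤c[1-x] i = 0≤r∧q≡p+r⇒p≤q (4ℚ * z * (¼ - z) + c * (z - x i))
    (0≤+ (0≤* (0≤* (ℚ.nonNegative⁻¹ 4ℚ) 0≤z) (p≤q⇒0≤q-p z≤¼))
         (0≤* (0≤+ (ℚ.nonNegative⁻¹ 3ℚ) (0≤* (ℚ.nonNegative⁻¹ 4ℚ) 0≤z)) (p≤q⇒0≤q-p (x≤z i))))
    (solve 2 (λ z x → (con 3ℚ :+ con 4ℚ :* z) :* (con 1ℚ :- x) :=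
       con 3ℚ :+ (con 4ℚ :* z :* (con ¼ :- z) :+ (con 3ℚ :+ con 4ℚ :* z) :* (z :- x))) refl z (x i))

  -- The left side never increases with N and equals the right side at N = 0. With x' = -½ x, the
  -- term bound 3x + c x² is the telescoping difference 2 (x - x') + (4/3) c (x² - x'²).
  sumTo-upper : ∀ N → sumTo f N + 2ℚ * x N + 4/3 * c * (x N * x N) ≤ 2ℚ * z + 4/3 * c * (z * z)
  sumTo-upper zero = ℚ.≤-reflexive (trans
    (cong (λ y → 0ℚ + 2ℚ * y + 4/3 * c * (y * y)) x₀≡z)
    (cong (_+ 4/3 * c * (z * z)) (ℚ.+-identityˡ (2ℚ * z))))
  sumTo-upper (suc N) = begin
    (P + f N) + 2ℚ * x (suc N) + 4/3 * c * (x (suc N) * x (suc N))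
      ≡⟨ cong (λ y → (P + f N) + 2ℚ * y + 4/3 * c * (y * y)) (x-step N) ⟩
    (P + f N) + 2ℚ * (-½ * y) + 4/3 * c * ((-½ * y) * (-½ * y))
      ≤⟨ 0≤r∧q≡p+r⇒p≤q (3ℚ * y + c * (y * y) - f N)
           (p≤q⇒0≤q-p (a≤3x+cx² (f N) (x N) (closed N) {c} (0<1-x N) (3≤c[1-x] N)))
           (solve 4 (λ P a c y → P :+ con 2ℚ :* y :+ con 4/3 :* c :* (y :* y) :=
             (P :+ a) :+ con 2ℚ :* (con -½ :* y) :+ con 4/3 :* c :* ((con -½ :* y) :* (con -½ :* y))
             :+ (con 3ℚ :* y :+ c :* (y :* y) :- a)) refl P (f N) c y) ⟩
    P + 2ℚ * y + 4/3 * c * (y * y)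
      ≤⟨ sumTo-upper N ⟩
    2ℚ * z + 4/3 * c * (z * z) ∎
    where
    open ℚ.≤-Reasoning
    P y : ℚ
    P = sumTo f N
    y = x N

  -- Only the first term, where x = z > 0, supplies the extra 3 z²; later terms are bounded below by
  -- 3x alone. Hence the induction starts after one term.
  sumTo-lower : ∀ N → 2ℚ * z + 3ℚ * (z * z) ≤ sumTo f (suc N) + 2ℚ * x (suc N)
  sumTo-lower zero = begin
    2ℚ * z + 3ℚ * (z * z)
      ≤⟨ 0≤r∧q≡p+r⇒p≤q (f 0 - (3ℚ * z + 3ℚ * (z * z)))
           (p≤q⇒0≤q-p (3x+3x²≤a (f 0) z (subst (λ y → f 0 * (1ℚ - y) ≡ 3ℚ * y) x₀≡z (closed 0)) (p≤¼⇒0<1-p z≤¼) 0≤z))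
           (solve 2 (λ a z → con 0ℚ :+ a :+ con 2ℚ :* (con -½ :* z) := con 2ℚ :* z :+ con 3ℚ :* (z :* z)
             :+ (a :- (con 3ℚ :* z :+ con 3ℚ :* (z :* z)))) refl (f 0) z) ⟩
    0ℚ + f 0 + 2ℚ * (-½ * z)
      ≡⟨ cong (λ y → 0ℚ + f 0 + 2ℚ * y) (trans (x-step 0) (cong (-½ *_) x₀≡z)) ⟨
    0ℚ + f 0 + 2ℚ * x 1 ∎
    where open ℚ.≤-Reasoning
  sumTo-lower (suc N) = begin
    2ℚ * z + 3ℚ * (z * z)
      ≤⟨ sumTo-lower N ⟩
    P + 2ℚ * y
      ≤⟨ 0≤r∧q≡p+r⇒p≤q (f (suc N) - 3ℚ * y)
           (p≤q⇒0≤q-p (3x≤a (f (suc N)) (x (suc N)) (closed (suc N)) (0<1-x (suc N))))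
           (solve 3 (λ P a y → P :+ a :+ con 2ℚ :* (con -½ :* y) :=
              P :+ con 2ℚ :* y :+ (a :- con 3ℚ :* y)) refl P (f (suc N)) y) ⟩
    P + f (suc N) + 2ℚ * (-½ * y)
      ≡⟨ cong (λ u → P + f (suc N) + 2ℚ * u) (x-step (suc N)) ⟨
    P + f (suc N) + 2ℚ * x (suc (suc N)) ∎
    where
    open ℚ.≤-Reasoning
    P y : ℚ
    P = sumTo f (suc N)
    y = x (suc N)

  -- With 2 z q = 1 this is P ≤ 1 / (q - 1) without division. The hypothesis makes |x_N| at most z³.
  eventually-upper : ∀ N → ½ ^ N ≤ z * z → sumTo f N * (1ℚ - 2ℚ * z) ≤ 2ℚ * z
  eventually-upper N v≤z² = ℚ.≤-trans
    (ℚ.*-monoʳ-≤-nonNeg (1ℚ - 2ℚ * z) {{ℚ.nonNegative 0≤1-2z}} P≤)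
    -- Expanding (2 z + 4 z² + (22/3) z³) (1 - 2 z) cancels the z² terms and leaves 2 z - (2/3) z³ -
    -- (44/3) z⁴.
    (0≤r∧q≡p+r⇒p≤q (2/3 * (z * (z * z)) + 44/3 * (z * (z * (z * z))))
      (0≤+ (0≤* (ℚ.nonNegative⁻¹ 2/3) (0≤* 0≤z (0≤p*p z)))
           (0≤* (ℚ.nonNegative⁻¹ 44/3) (0≤* 0≤z (0≤* 0≤z (0≤p*p z)))))
      (solve 1 (λ z → con 2ℚ :* z :=
        (con 2ℚ :* z :+ con 4/3 :* (con 3ℚ :+ con 4ℚ :* z) :* (z :* z) :+ con 2ℚ :* (z :* (z :* z))) :* (con 1ℚ :- con 2ℚ :* z)
        :+ (con 2/3 :* (z :* (z :* z)) :+ con 44/3 :* (z :* (z :* (z :* z))))) refl z))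
    where
    2/3 44/3 P y v U : ℚ
    2/3 = + 2 / 3
    44/3 = + 44 / 3
    P = sumTo f N
    y = x N
    v = ½ ^ N
    U = 2ℚ * z + 4/3 * c * (z * z)
    0≤c : 0ℚ ≤ c
    0≤c = 0≤+ (ℚ.nonNegative⁻¹ 3ℚ) (0≤* (ℚ.nonNegative⁻¹ 4ℚ) 0≤z)
    0≤1-2z : 0ℚ ≤ 1ℚ - 2ℚ * z
    0≤1-2z = 0≤r∧q≡p+r⇒p≤q (2ℚ * (¼ - z) + ½)
      (0≤+ (0≤* (ℚ.nonNegative⁻¹ 2ℚ) (p≤q⇒0≤q-p z≤¼)) (ℚ.nonNegative⁻¹ ½))
      (solve 1 (λ z → con 1ℚ :- con 2ℚ :* z := con 0ℚ :+ (con 2ℚ :* (con ¼ :- z) :+ con ½)) refl z)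
    P≤ : P ≤ U + 2ℚ * (z * (z * z))
    -- The summands are the slacks of `sumTo-upper`, of dropping the square, of - x_N ≤ z ½^N and of
    -- ½^N ≤ z².
    P≤ = 0≤r∧q≡p+r⇒p≤q
      ((U - (P + 2ℚ * y + 4/3 * c * (y * y))) + 4/3 * c * (y * y) + 2ℚ * (z * v - - y) + 2ℚ * (z * (z * z - v)))
      (0≤+ (0≤+ (0≤+ (p≤q⇒0≤q-p (sumTo-upper N)) (0≤* (0≤* (ℚ.nonNegative⁻¹ 4/3) 0≤c) (0≤p*p y)))
        (0≤* (ℚ.nonNegative⁻¹ 2ℚ) (p≤q⇒0≤q-p (-x≤z½^ N))))
        (0≤* (ℚ.nonNegative⁻¹ 2ℚ) (0≤* 0≤z (p≤q⇒0≤q-p v≤z²))))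
      (solve 6 (λ U P c y z v → U :+ con 2ℚ :* (z :* (z :* z)) :=
        P :+ ((U :- (P :+ con 2ℚ :* y :+ con 4/3 :* c :* (y :* y))) :+ con 4/3 :* c :* (y :* y)
          :+ con 2ℚ :* (z :* v :- (:- y)) :+ con 2ℚ :* (z :* (z :* z :- v)))) refl U P c y z v)

  -- Of the surplus 3 z² in `sumTo-lower`, the term 2 x consumes at most 2 z³ ≤ 2 z², and z² is left
  -- as margin.
  eventually-lower : ∀ N → ½ ^ suc N ≤ z * z → 2ℚ * z + z * z ≤ sumTo f (suc N)
  eventually-lower N v≤z² = 0≤r∧q≡p+r⇒p≤q
    ((P + 2ℚ * y - (2ℚ * z + 3ℚ * (z * z))) + 2ℚ * (z * v - y) + 2ℚ * (z * (z * z - v)) + 2ℚ * ((z * z) * (1ℚ - z)))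
    (0≤+ (0≤+ (0≤+ (p≤q⇒0≤q-p (sumTo-lower N)) (0≤* 0≤2 (p≤q⇒0≤q-p (x≤z½^ (suc N)))))
      (0≤* 0≤2 (0≤* 0≤z (p≤q⇒0≤q-p v≤z²)))) (0≤* 0≤2 (0≤* (0≤p*p z) (ℚ.<⇒≤ (p≤¼⇒0<1-p z≤¼)))))
    (solve 4 (λ P y z v → P := con 2ℚ :* z :+ z :* z :+
      ((P :+ con 2ℚ :* y :- (con 2ℚ :* z :+ con 3ℚ :* (z :* z))) :+ con 2ℚ :* (z :* v :- y)
        :+ con 2ℚ :* (z :* (z :* z :- v)) :+ con 2ℚ :* ((z :* z) :* (con 1ℚ :- z)))) refl P y z v)
    where
    0≤2 : 0ℚ ≤ 2ℚ
    0≤2 = ℚ.nonNegative⁻¹ 2ℚ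
    P y v : ℚ
    P = sumTo f (suc N)
    y = x (suc N)
    v = ½ ^ suc N

-- The floor of the reciprocal from eventual bounds on the sequence

module InverseFloor (S : ℝ) (q : ℕ) (z : ℚ) (0<z : 0ℚ < z) (z≤¼ : z ≤ ¼) (2zq≡1 : 2ℚ * z * ι (+ q) ≡ 1ℚ)
  (N : ℕ) (lower : ∀ j → N ℕ.≤ j → 2ℚ * z + z * z ≤ seq S j)
  (upper : ∀ j → N ℕ.≤ j → seq S j * (1ℚ - 2ℚ * z) ≤ 2ℚ * z) where

  Q : ℚ
  Q = ι (+ q)

  0≤Q : 0ℚ ≤ Q
  0≤Q = ι-nonNeg {+ q} (ℤ.+≤+ ℕ.z≤n)

  0<z² : 0ℚ < z * z
  0<z² = 0<* 0<z 0<z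

  z²≤S : ∀ j → N ℕ.≤ j → z * z ≤ seq S j
  z²≤S j N≤j = ℚ.≤-trans
    (0≤r∧q≡p+r⇒p≤q (2ℚ * z) (0≤* (ℚ.nonNegative⁻¹ 2ℚ) (ℚ.<⇒≤ 0<z)) (ℚ.+-comm (2ℚ * z) (z * z)))
    (lower j N≤j)

  0<S : ∀ j → N ℕ.≤ j → 0ℚ < seq S j
  0<S j N≤j = ℚ.<-≤-trans 0<z² (z²≤S j N≤j)

  S#0 : S # 0ℝ
  S#0 = inj₂ (z * z , 0<z² , N , λ j N≤j → subst (_≤ seq S j) (sym (ℚ.+-identityˡ (z * z))) (z²≤S j N≤j))

  recip*S≡1 : ∀ j → N ℕ.≤ j → recip (seq S j) * seq S j ≡ 1ℚ
  recip*S≡1 j N≤j = recip-inverseˡ (seq S j) λ Sj≡0 → ℚ.<-irrefl (sym Sj≡0) (0<S j N≤j)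

  -- As 1 = 2 z Q, the product (Q - 1) P is Q · P (1 - 2 z), and the upper bound on P makes this at
  -- most Q · 2 z = 1.
  Q-1≤recip : ∀ j → N ℕ.≤ j → Q - 1ℚ ≤ recip (seq S j)
  Q-1≤recip j N≤j = *-cancelʳ-≤ (0<S j N≤j) (begin
    (Q - 1ℚ) * P                  ≡⟨ cong (λ r → (Q - r) * P) 2zq≡1 ⟨
    (Q - 2ℚ * z * Q) * P          ≡⟨ solve 3 (λ Q z P → (Q :- con 2ℚ :* z :* Q) :* P := Q :* (P :* (con 1ℚ :- con 2ℚ :* z))) refl Q z P ⟩
    Q * (P * (1ℚ - 2ℚ * z))       ≤⟨ ℚ.*-monoˡ-≤-nonNeg Q {{ℚ.nonNegative 0≤Q}} (upper j N≤j) ⟩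
    Q * (2ℚ * z)                  ≡⟨ trans (ℚ.*-comm Q (2ℚ * z)) 2zq≡1 ⟩
    1ℚ                            ≡⟨ recip*S≡1 j N≤j ⟨
    recip P * P                   ∎)
    where
    open ℚ.≤-Reasoning
    P : ℚ
    P = seq S j

  -- A bare `recip P` < Q at each index would not exclude Q as a lower bound of the limit; the gap
  -- z² is uniform in j. If it failed, Q would be at most P, hence Q - 1 ≤ 2 z, and then 1 = 2 z (Q
  -- - 1) + 2 z ≤ ¼ + ½.
  recip+z²<Q : ∀ j → N ℕ.≤ j → recip (seq S j) + z * z < Q
  recip+z²<Q j N≤j = ℚ.≰⇒> λ Q≤ → ℚ.<-irrefl refl (ℚ.<-≤-trans 3/4<1 (begin
    1ℚ                                ≡⟨ trans (sym (ℚ.+-identityʳ 1ℚ)) (sym (cong₂ (λ a b → a + b) 2zq≡1 (ℚ.+-inverseʳ (2ℚ * z)))) ⟩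
    2ℚ * z * Q + (2ℚ * z - 2ℚ * z)    ≡⟨ solve 2 (λ z Q → con 2ℚ :* z :* Q :+ (con 2ℚ :* z :- con 2ℚ :* z) :=
                                           con 2ℚ :* z :* (Q :- con 1ℚ) :+ con 2ℚ :* z) refl z Q ⟩
    2ℚ * z * (Q - 1ℚ) + 2ℚ * z        ≤⟨ ℚ.+-monoˡ-≤ (2ℚ * z) (ℚ.*-monoˡ-≤-nonNeg (2ℚ * z) {{ℚ.nonNegative 0≤2z}} (Q-1≤2z Q≤)) ⟩
    2ℚ * z * (2ℚ * z) + 2ℚ * z        ≤⟨ ℚ.+-mono-≤ (ℚ.≤-trans (ℚ.*-monoˡ-≤-nonNeg (2ℚ * z) {{ℚ.nonNegative 0≤2z}} 2z≤½)
                                           (ℚ.*-monoʳ-≤-nonNeg ½ 2z≤½)) 2z≤½ ⟩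
    ½ * ½ + ½                         ∎))
    where
    open ℚ.≤-Reasoning
    P R : ℚ
    P = seq S j
    R = recip P
    3/4<1 : ½ * ½ + ½ < 1ℚ
    3/4<1 = ℚ.*<* (ℤ.+<+ (ℕ.s≤s (ℕ.s≤s (ℕ.s≤s (ℕ.s≤s ℕ.z≤n)))))
    2z≤½ : 2ℚ * z ≤ ½
    2z≤½ = ℚ.*-monoˡ-≤-nonNeg 2ℚ z≤¼
    0≤2z : 0ℚ ≤ 2ℚ * z
    0≤2z = 0≤* (ℚ.nonNegative⁻¹ 2ℚ) (ℚ.<⇒≤ 0<z)
    Q≤P : Q ≤ R + z * z → Q ≤ P
    -- Compare 1 + Q z² = Q (2 z + z²) ≤ Q P with Q P ≤ (R + z²) P = 1 + z² P, and cancel z².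
    Q≤P Q≤ = *-cancelʳ-≤ 0<z² (0≤r∧q≡p+r⇒p≤q
      (((R + z * z) * P - Q * P) + Q * (P - (2ℚ * z + z * z)))
      (0≤+ (p≤q⇒0≤q-p (ℚ.*-monoʳ-≤-nonNeg P {{ℚ.nonNegative (ℚ.<⇒≤ (0<S j N≤j))}} Q≤))
           (0≤* 0≤Q (p≤q⇒0≤q-p (lower j N≤j))))
      (trans (trans
        (solve 2 (λ P z → P :* (z :* z) := P :* (z :* z) :+ (con 1ℚ :- con 1ℚ)) refl P z)
        (cong₂ (λ a b → P * (z * z) + (a - b)) (sym (recip*S≡1 j N≤j)) (sym 2zq≡1)))
        (solve 4 (λ P R Q z → P :* (z :* z) :+ (R :* P :- con 2ℚ :* z :* Q) :=
          Q :* (z :* z) :+ (((R :+ z :* z) :* P :- Q :* P) :+ Q :* (P :- (con 2ℚ :* z :+ z :* z)))) refl P R Q z)))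
    0≤1-2z : 0ℚ ≤ 1ℚ - 2ℚ * z
    0≤1-2z = p≤q⇒0≤q-p (ℚ.≤-trans 2z≤½ (0≤r∧q≡p+r⇒p≤q ½ (ℚ.nonNegative⁻¹ ½) refl))
    Q-1≤2z : Q ≤ R + z * z → Q - 1ℚ ≤ 2ℚ * z
    Q-1≤2z Q≤ = begin
      Q - 1ℚ               ≡⟨ cong (λ r → Q - r) 2zq≡1 ⟨
      Q - 2ℚ * z * Q       ≡⟨ solve 2 (λ Q z → Q :- con 2ℚ :* z :* Q := Q :* (con 1ℚ :- con 2ℚ :* z)) refl Q z ⟩
      Q * (1ℚ - 2ℚ * z)    ≤⟨ ℚ.*-monoʳ-≤-nonNeg (1ℚ - 2ℚ * z) {{ℚ.nonNegative 0≤1-2z}} (Q≤P Q≤) ⟩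
      P * (1ℚ - 2ℚ * z)    ≤⟨ upper j N≤j ⟩
      2ℚ * z               ∎

  inv-floor : IsFloor (inv S S#0) (+ q ℤ.- 1ℤ)
  inv-floor = below , above
    where
    below : fromℤ (+ q ℤ.- 1ℤ) Defs.≤ inv S S#0
    below ε 0<ε = N , λ j N≤j → ℚ.≤-trans
      (subst (_≤ recip (seq S j)) (sym (ι-homo-+ (+ q) -1ℤ)) (Q-1≤recip j N≤j))
      (0≤r∧q≡p+r⇒p≤q ε (ℚ.<⇒≤ 0<ε) refl)
    above : ∀ k → fromℤ k Defs.≤ inv S S#0 → k ℤ.≤ + q ℤ.- 1ℤ
    above k k≤ with + q ℤ.≤? k
    ... | no q≰k = subst (k ℤ.≤_) (ℤ.+-comm -1ℤ (+ q)) (ℤ.i<j⇒i≤pred[j] (ℤ.≰⇒> q≰k))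
    ... | yes q≤k =
      -- Taking the tolerance equal to the gap z² gives q ≤ k ≤ recip + z² < q at a common index.
      let (M , k≤recip+z²) = k≤ (z * z) 0<z²
          j = N ℕ.⊔ M
      in contradiction
           (ℚ.<-≤-trans (recip+z²<Q j (ℕ.m≤m⊔n N M))
             (ℚ.≤-trans (ι-mono-≤ q≤k) (k≤recip+z² j (ℕ.m≤n⊔m N M))))
           (ℚ.<-irrefl refl)

-- The tail for even n, with z = ½^n and q = 2^(n-1)

theorem3p1 : (n : ℕ) .{{_ : NonZero n}} → 2 ∣ n →
    Σ[ S ∈ ℝ ] HasSum (alternatingTail n) S ×
    (Σ[ S#0 ∈ S # 0ℝ ] IsFloor (inv S S#0) ((+ (2 ℕ.^ (n ℕ.∸ 1))) ℤ.- 1ℤ))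
theorem3p1 n (divides zero refl) = contradiction refl (ℕ.≢-nonZero⁻¹ 0)
theorem3p1 n (divides (suc m) refl) =
  -- From index 2n on, ½^j ≤ ½^(2n) = z²; the successor ensures at least one term, as the lower
  -- bound requires.
  S , HasSum-sumTo f cauchy-f , InverseFloor.S#0 S q z 0<z z≤¼ 2zq≡1 (suc (n ℕ.+ n)) lower upper ,
  InverseFloor.inv-floor S q z 0<z z≤¼ 2zq≡1 (suc (n ℕ.+ n)) lower upper
  where
  k q : ℕ
  -- Here n = suc m * 2 reduces to `suc k`, so k is n - 1.
  k = suc (m ℕ.* 2)
  q = 2 ℕ.^ k

  f : ℕ → ℚ
  f i = alternatingReciprocal (n ℕ.+ i)

  z : ℚ
  z = ½ ^ n

  0<z : 0ℚ < z
  0<z = ½^-pos n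

  z≤¼ : z ≤ ¼
  z≤¼ = ½^-antimono {2} {n} (ℕ.s≤s (ℕ.s≤s ℕ.z≤n))

  -½^[n+i]≡z*-½^i : ∀ i → -½ ^ (n ℕ.+ i) ≡ z * -½ ^ i
  -- Evenness of n enters here: it makes (-½)^n the positive number z.
  -½^[n+i]≡z*-½^i i = trans (^-homo-* -½ n i) (cong (_* -½ ^ i) (-½^-even (suc m)))

  f-closed : ∀ i → f i * (1ℚ - z * -½ ^ i) ≡ 3ℚ * (z * -½ ^ i)
  f-closed i = subst (λ x → f i * (1ℚ - x) ≡ 3ℚ * x) (-½^[n+i]≡z*-½^i i)
    (alternatingReciprocal-closed (n ℕ.+ i))

  open TailBounds f z 0<z z≤¼ f-closed

  S : ℝ
  S = mkℝ (sumTo f) cauchy-f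

  2zq≡1 : 2ℚ * z * ι (+ q) ≡ 1ℚ
  2zq≡1 = trans (cong (_* ι (+ q)) (solve 1 (λ w → con 2ℚ :* (con ½ :* w) := w) refl (½ ^ k))) (½^*2^≡1 k)

  ½^≤z² : ∀ {j} → n ℕ.+ n ℕ.≤ j → ½ ^ j ≤ z * z
  ½^≤z² {j} n+n≤j = subst (½ ^ j ≤_) (^-homo-* ½ n n) (½^-antimono n+n≤j)

  lower : ∀ j → suc (n ℕ.+ n) ℕ.≤ j → 2ℚ * z + z * z ≤ seq S j
  lower (suc j) n+n<j = eventually-lower j (½^≤z² (ℕ.<⇒≤ n+n<j))

  upper : ∀ j → suc (n ℕ.+ n) ℕ.≤ j → seq S j * (1ℚ - 2ℚ * z) ≤ 2ℚ * z
  upper j n+n<j = eventually-upper j (½^≤z² (ℕ.<⇒≤ n+n<j))
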